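{- If $H=(V,\Delta)$ is a Steiner triple system on $|V|=n$ vertices, then $H$ has $\Omega\big((n/6)^{n/12}\big)$ spanning trees (as $n\to\infty$).
   Context: A 3-graph is $H=(V,\Delta)$ with $\Delta\subseteq\binom V3$ (triples). It is a Steiner triple system if every pair of distinct vertices is contained in exactly one triple. A cycle in $H$ is a sequence $a_0,t_1,a_1,\dots,t_\ell,a_\ell=a_0$, $\ell\ge2$, with distinct vertices $a_0,\dots,a_{\ell-1}$, distinct triples, $a_{i-1},a_i\in t_i$. A spanning tree is a set of triples containing no cycle, covering $V$, and connected via paths of triples of $T$. -}

module Defs where

open import Level using (Level; 0ℓ)
open import Data.Nat using (ℕ; zero; suc; _+_; _*_; _^_; _≤_; _<_)
open import Data.Fin using (Fin)
open import Data.Fin.Subset using (Subset; _∈_; ∣_∣)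
open import Data.Product using (Σ; ∃; _×_; _,_)
open import Data.Sum using (_⊎_)
open import Relation.Nullary using (¬_)
open import Relation.Binary.PropositionalEquality using (_≡_; _≢_)

TripleSet : ℕ → Set₁
TripleSet n = Subset n → Set

Is3Graph : {n : ℕ} → TripleSet n → Set
Is3Graph {n} Δ = ∀ (t : Subset n) → Δ t → ∣ t ∣ ≡ 3

IsSTS : {n : ℕ} → TripleSet n → Set
IsSTS {n} Δ =
  Is3Graph Δ ×
  (∀ (x y : Fin n) → x ≢ y →
     (Σ (Subset n) λ t → Δ t × x ∈ t × y ∈ t) ×
     (∀ (t t' : Subset n) → Δ t → x ∈ t → y ∈ t → Δ t' → x ∈ t' → y ∈ t' → t ≡ t'))

_⊆ₜ_ : {n : ℕ} → TripleSet n → TripleSet n → Set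
_⊆ₜ_ {n} T Δ = ∀ (t : Subset n) → T t → Δ t

-- A cycle in T: a_0, t_1, a_1, ..., t_ℓ, a_ℓ = a_0 with ℓ ≥ 2, a_0..a_{ℓ-1}
-- distinct, t_1..t_ℓ distinct triples of T, a_{i-1}, a_i ∈ t_i.
-- Here a i = a_i and t i = t_{i+1} (0-based).
HasCycle : {n : ℕ} → TripleSet n → Set
HasCycle {n} T =
  Σ ℕ λ ℓ → Σ (ℕ → Fin n) λ a → Σ (ℕ → Subset n) λ t →
    2 ≤ ℓ ×
    a ℓ ≡ a 0 ×
    (∀ i j → i < ℓ → j < ℓ → i ≢ j → a i ≢ a j) ×
    (∀ i j → i < ℓ → j < ℓ → i ≢ j → t i ≢ t j) ×
    (∀ i → i < ℓ → T (t i) × a i ∈ t i × a (suc i) ∈ t i)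

data Reach {n : ℕ} (T : TripleSet n) (u : Fin n) : Fin n → Set where
  here : Reach T u u
  step : ∀ {w v} (t : Subset n) → Reach T u w → T t → w ∈ t → v ∈ t → Reach T u v

IsSpanningTree : {n : ℕ} → TripleSet n → TripleSet n → Set
IsSpanningTree {n} Δ T =
  T ⊆ₜ Δ ×
  ¬ HasCycle T ×
  (∀ (x : Fin n) → Σ (Subset n) λ t → T t × x ∈ t) ×
  (∀ (u v : Fin n) → Reach T u v)

Different : {n : ℕ} → TripleSet n → TripleSet n → Set
Different {n} T₁ T₂ = Σ (Subset n) λ t → (T₁ t × ¬ T₂ t) ⊎ (T₂ t × ¬ T₁ t)

AtLeastSpanningTrees : {n : ℕ} → TripleSet n → ℕ → Set₁
AtLeastSpanningTrees {n} Δ L =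
  Σ (Fin L → TripleSet n) λ T →
    (∀ i → IsSpanningTree Δ (T i)) ×
    (∀ i j → i ≢ j → Different (T i) (T j))

module Submission where

-- A tree on a vertex set S has odd |S|. For any x ∉ S some s ∈ S has the third point of
-- the triple {s, x, ·} outside S, since otherwise these third points would pair up S; so
-- every tree can be grown at x to a spanning tree. Two different triples chosen at the
-- same x never lead to the same tree, because all later triples meet the enlarged S in a
-- single vertex. Hence the number of spanning trees is at least the product of the numbers
-- of choices. Counting the pairs (x, s), some x has more than k choices as soon as
-- n k < |S| (n - 2|S|); with q = ⌊n/16⌋ and k = ⌊q/2⌋ this covers 2q consecutive odd sizes
-- |S| ≥ 1 + 2q, which gives (k + 1)^(2q) spanning trees, roughly (n/32)^(n/8).

open import Defs
open import Data.Nat using (ℕ; zero; suc; _+_; _*_; _∸_; _^_; _/_; _%_; NonZero; _≤_; _<_; z≤n;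
  s≤s; _<?_; _≤?_; parity; >-nonZero)
open import Data.Nat.DivMod using (m≡m%n+[m/n]*n; m%n<n; m/n*n≤m; /-monoˡ-≤)
open import Data.Nat.Properties using (module ≤-Reasoning; +-0-commutativeMonoid; +-mono-≤;
  +-monoˡ-≤; +-monoʳ-≤; *-mono-≤; *-monoˡ-≤; *-monoʳ-≤; *-cancelˡ-<; *-identityˡ; *-identityʳ;
  +-identityʳ; +-suc; *-comm; ≤-refl; ≤-reflexive; ≤-trans; ≤-pred; n<1+n; n≤1+n; m≤m+n; m≤n+m;
  ≮⇒≥; ≤-antisym; <⇒≱; suc-injective; anyUpTo?; m+n≤o⇒m≤o∸n; m≤n+o⇒m∸n≤o; m≤n*m; ^-monoˡ-≤;
  ^-monoʳ-≤; ^-*-assoc; ^-distribˡ-+-*; m*n≢0; m^n≢0; ≤ᵇ⇒≤; *-distribʳ-+)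
open import Data.Nat.Tactic.RingSolver using (solve-∀)
open import Data.Parity.Base using (1ℙ; 0ℙ)
open import Data.Bool using (if_then_else_)
open import Data.Bool.Properties using () renaming (_≟_ to _≟ᵇ_)
open import Data.Fin using (Fin; zero; suc; fromℕ<; inject≤; remQuot; combine)
open import Data.Fin.Properties using (_≟_; any?; inject≤-injective; combine-remQuot)
  renaming (suc-injective to fsuc-injective)
open import Data.Fin.Permutation using (permutation)
open import Data.Fin.Subset using (Subset; inside; outside; _∈_; _∉_; _⊆_; ∣_∣; ⁅_⁆; _∪_; _─_;
  _-_; ⊤)
open import Data.Fin.Subset.Properties using (_∈?_; nonempty?; Empty-unique; ∣⊥∣≡0; ∪-identityʳ;
  ∪-assoc; p─⊥≡p; x∈p∧x≢y⇒x∈p-y; p─q⊆p; x∈⁅x⁆; x∈⁅y⁆⇒x≡y; ∣⁅x⁆∣≡1; ∈⊤; ∣⊤∣≡n; ∣p∣≡n⇒p≡⊤; ∣p∣≤n;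
  p⊆q⇒∣p∣≤∣q∣; p⊆p∪q; q⊆p∪q; x∈p∪q⁻)
open import Data.Vec using ([]; _∷_; here; there)
open import Data.Vec.Properties using (≡-dec)
open import Data.List using (List; []; _∷_)
open import Data.List.Membership.Propositional using () renaming (_∈_ to _∈ₗ_; _∉_ to _∉ₗ_)
open import Data.List.Relation.Unary.Any using (here; there)
open import Data.Product using (Σ; ∃; ∃₂; _×_; _,_; proj₁; proj₂)
open import Data.Sum using (_⊎_; inj₁; inj₂; [_,_]′)
open import Function using (_∘_; case_of_)
open import Relation.Nullary using (¬_; Dec; yes; no; does; contradiction; ¬?; _×-dec_)
open import Relation.Nullary.Decidable using (decidable-stable)
open import Relation.Unary using (Pred; Decidable)
open import Relation.Binary.PropositionalEquality using (_≡_; _≢_; refl; sym; trans; cong; subst;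
  module ≡-Reasoning)
open import Level using (0ℓ)
open import Algebra.Properties.CommutativeMonoid.Sum +-0-commutativeMonoid using (sum;
  ∑-distrib-+; ∑-comm; sum-permute)

-- Finite sums and cardinalities

sum-mono : ∀ {n} {f g : Fin n → ℕ} → (∀ i → f i ≤ g i) → sum f ≤ sum g
sum-mono {zero}  f≤g = z≤n
sum-mono {suc n} f≤g = +-mono-≤ (f≤g zero) (sum-mono (f≤g ∘ suc))

sum-const : ∀ n c → sum {n} (λ _ → c) ≡ n * c
sum-const zero    c = refl
sum-const (suc n) c = cong (c +_) (sum-const n c)

sum-*ʳ : ∀ {n} (f : Fin n → ℕ) c → sum (λ i → f i * c) ≡ sum f * c
sum-*ʳ {zero}  f c = refl
sum-*ʳ {suc n} f c = trans (cong (f zero * c +_) (sum-*ʳ (f ∘ suc) c))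
  (sym (*-distribʳ-+ c (f zero) _))

ind : ∀ {A : Set} → Dec A → ℕ
ind d = if does d then 1 else 0

ind-*-≤ : ∀ {A : Set} (d : Dec A) {c k} → (A → c ≤ k) → ind d * c ≤ k
ind-*-≤ (yes a) {c} c≤k = ≤-trans (≤-reflexive (*-identityˡ c)) (c≤k a)
ind-*-≤ (no  _)     _   = z≤n

card : ∀ {n} {P : Pred (Fin n) 0ℓ} → Decidable P → ℕ
card P? = sum (λ i → ind (P? i))

∣p∣≡card : ∀ {n} (p : Subset n) → ∣ p ∣ ≡ card (_∈? p)
∣p∣≡card []            = refl
∣p∣≡card (inside  ∷ p) = cong suc (∣p∣≡card p)
∣p∣≡card (outside ∷ p) = ∣p∣≡card p

-- An injective listing is the form in which `branch` takes its choices.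
enumerate : ∀ {n} {P : Pred (Fin n) 0ℓ} (P? : Decidable P) →
  Σ (Fin (card P?) → Fin n) λ e → (∀ i → P (e i)) × (∀ i j → e i ≡ e j → i ≡ j)
enumerate {zero}  P? = (λ ()) , (λ ()) , λ ()
enumerate {suc n} P? with enumerate (P? ∘ suc) | P? zero
... | e , e∈P , e-inj | no _ = suc ∘ e , e∈P , λ i j → e-inj i j ∘ fsuc-injective
... | e , e∈P , e-inj | yes p = e′ , e′∈P , e′-inj
  where
  e′ : _ → _
  e′ zero    = zero
  e′ (suc i) = suc (e i)
  e′∈P : ∀ i → _
  e′∈P zero    = p
  e′∈P (suc i) = e∈P i
  e′-inj : ∀ i j → e′ i ≡ e′ j → i ≡ j
  e′-inj zero    zero    _  = refl
  e′-inj zero    (suc j) ()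
  e′-inj (suc i) zero    ()
  e′-inj (suc i) (suc j) eq = cong suc (e-inj i j (fsuc-injective eq))

-- Removing and adding single points

∣p-x∣ : ∀ {n} {p : Subset n} {x} → x ∈ p → suc ∣ p - x ∣ ≡ ∣ p ∣
∣p-x∣ {p = _ ∷ p} here = cong (suc ∘ ∣_∣) (p─⊥≡p p)
∣p-x∣ {p = inside  ∷ p} (there x∈p) = cong suc (∣p-x∣ x∈p)
∣p-x∣ {p = outside ∷ p} (there x∈p) = ∣p-x∣ x∈p

∣p∪x∣ : ∀ {n} {p : Subset n} {x} → x ∉ p → ∣ p ∪ ⁅ x ⁆ ∣ ≡ suc ∣ p ∣
∣p∪x∣ {p = inside  ∷ p} {zero}  x∉p = contradiction here x∉p
∣p∪x∣ {p = outside ∷ p} {zero}  x∉p = cong (suc ∘ ∣_∣) (∪-identityʳ p)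
∣p∪x∣ {p = inside  ∷ p} {suc x} x∉p = cong suc (∣p∪x∣ (x∉p ∘ there))
∣p∪x∣ {p = outside ∷ p} {suc x} x∉p = ∣p∪x∣ (x∉p ∘ there)

x∉p-x : ∀ {n} (p : Subset n) x → x ∉ p - x
x∉p-x (_ ∷ p) zero    ()
x∉p-x (_ ∷ p) (suc x) (there x∈) = x∉p-x p x x∈

∈-⇒≢ : ∀ {n} {p : Subset n} {x y} → y ∈ p - x → y ≢ x
∈-⇒≢ {p = p} {x} y∈ refl = x∉p-x p x y∈

∈-⇒∈ : ∀ {n} {p : Subset n} {x y} → y ∈ p - x → y ∈ p
∈-⇒∈ {p = p} {x} = p─q⊆p p ⁅ x ⁆

pick : ∀ {n} {p : Subset n} {k} → ∣ p ∣ ≡ suc k → ∃ λ x → x ∈ p × ∣ p - x ∣ ≡ k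
pick {n} {p} ∣p∣ with nonempty? p
... | yes (x , x∈p) = x , x∈p , suc-injective (trans (∣p-x∣ x∈p) ∣p∣)
... | no  ∄x = contradiction (trans (sym ∣p∣) (trans (cong ∣_∣ (Empty-unique ∄x)) (∣⊥∣≡0 n))) λ ()

∣p∣≡0⇒x∉p : ∀ {n} {p : Subset n} → ∣ p ∣ ≡ 0 → ∀ {x} → x ∉ p
∣p∣≡0⇒x∉p ∣p∣≡0 x∈p = contradiction (trans (∣p-x∣ x∈p) ∣p∣≡0) λ ()

∃∉ : ∀ {n} {p : Subset n} → ∣ p ∣ < n → ∃ (_∉ p)
∃∉ {n} {p} ∣p∣<n with any? (λ x → ¬? (x ∈? p))
... | yes ∃x = ∃x
... | no  ∄x = contradiction
  (≤-trans (≤-reflexive (sym (∣⊤∣≡n n)))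
    (p⊆q⇒∣p∣≤∣q∣ {p = ⊤} λ {x} _ → decidable-stable (x ∈? p) (λ x∉ → ∄x (x , x∉))))
  (<⇒≱ ∣p∣<n)

-- Deleting `x` and its partner `f x` lowers the size by two. The bound `k` is fuel, since the
-- remaining set is not structurally smaller than `p`.
involution⇒even : ∀ {n} (f : Fin n → Fin n) k (p : Subset n) → ∣ p ∣ ≤ k →
  (∀ {x} → x ∈ p → f x ∈ p × f x ≢ x × f (f x) ≡ x) → parity ∣ p ∣ ≡ 0ℙ
involution⇒even f k p ∣p∣≤k inv with ∣ p ∣ in eq
involution⇒even f k p _ inv | zero = refl
involution⇒even f (suc k) p (s≤s c≤k) inv | suc c
  with x , x∈p , ∣p-x∣≡c ← pick {p = p} eq
  = subst (λ c → parity (suc c) ≡ 0ℙ) (trans (∣p-x∣ fx∈) ∣p-x∣≡c)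
      (involution⇒even f k (p - x - f x)
        (≤-trans (n≤1+n _) (≤-trans (≤-reflexive (trans (∣p-x∣ fx∈) ∣p-x∣≡c)) c≤k)) inv′)
  where
  fx∈ : f x ∈ p - x
  fx∈ = let fx∈p , fx≢x , _ = inv x∈p in x∈p∧x≢y⇒x∈p-y fx∈p fx≢x
  -- A remaining `y` is not sent to `x` or `f x`: applying `f` again would make `y` equal to `f x`
  -- or `x`, both deleted.
  inv′ : ∀ {y} → y ∈ p - x - f x → f y ∈ p - x - f x × f y ≢ y × f (f y) ≡ y
  inv′ {y} y∈ =
    let y∈p-x = ∈-⇒∈ y∈
        fy∈p , fy≢y , ffy≡y = inv (∈-⇒∈ y∈p-x)
        _ , _ , ffx≡x = inv x∈p
    in x∈p∧x≢y⇒x∈p-y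
         (x∈p∧x≢y⇒x∈p-y fy∈p λ fy≡x → ∈-⇒≢ y∈ (trans (sym ffy≡y) (cong f fy≡x)))
         (λ fy≡fx → ∈-⇒≢ y∈p-x (trans (sym ffy≡y) (trans (cong f fy≡fx) ffx≡x)))
       , fy≢y , ffy≡y

-- Trees grown in a Steiner triple system

module Growth {n : ℕ} (Δ : TripleSet n) (sts : IsSTS Δ) where

  -- The order of the points records their roles: when a tree is grown, the first lies in it and the
  -- other two are new.
  record Line (x y z : Fin n) (t : Subset n) : Set where
    field
      t∈Δ : Δ t
      x∈t : x ∈ t
      y∈t : y ∈ t
      z∈t : z ∈ t
      x≢y : x ≢ y
      x≢z : x ≢ z
      y≢z : y ≢ z
      only : ∀ {w} → w ∈ t → w ≡ x ⊎ w ≡ y ⊎ w ≡ z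

  open Line

  swap-xy : ∀ {x y z t} → Line x y z t → Line y x z t
  swap-xy l = record
    { t∈Δ = t∈Δ l ; x∈t = y∈t l ; y∈t = x∈t l ; z∈t = z∈t l
    ; x≢y = x≢y l ∘ sym ; x≢z = y≢z l ; y≢z = x≢z l
    ; only = λ w∈t → [ inj₂ ∘ inj₁ , [ inj₁ , inj₂ ∘ inj₂ ]′ ]′ (only l w∈t) }

  swap-yz : ∀ {x y z t} → Line x y z t → Line x z y t
  swap-yz l = record
    { t∈Δ = t∈Δ l ; x∈t = x∈t l ; y∈t = z∈t l ; z∈t = y∈t l
    ; x≢y = x≢z l ; x≢z = x≢y l ; y≢z = y≢z l ∘ sym
    ; only = λ w∈t → [ inj₁ , [ inj₂ ∘ inj₂ , inj₂ ∘ inj₁ ]′ ]′ (only l w∈t) }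

  -- Removing `x` and `y` from their triple leaves one point, taken as `z`; removing that too leaves
  -- nothing, which gives `only`.
  block : ∀ {x y} → x ≢ y → ∃₂ (Line x y)
  block {x} {y} x≢y
    with (t , t∈Δ , x∈t , y∈t) , _ ← proj₂ sts x y x≢y
    with y∈t-x ← x∈p∧x≢y⇒x∈p-y y∈t (x≢y ∘ sym)
    with ∣t-x∣ ← suc-injective (trans (∣p-x∣ x∈t) (proj₁ sts t t∈Δ))
    with ∣t-x-y∣ ← suc-injective (trans (∣p-x∣ y∈t-x) ∣t-x∣)
    with z , z∈ , ∣t-x-y-z∣ ← pick {p = t - x - y} ∣t-x-y∣
    = z , t , record
      { t∈Δ = t∈Δ ; x∈t = x∈t ; y∈t = y∈t ; z∈t = ∈-⇒∈ (∈-⇒∈ z∈)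
      ; x≢y = x≢y ; x≢z = ∈-⇒≢ (∈-⇒∈ z∈) ∘ sym ; y≢z = ∈-⇒≢ z∈ ∘ sym
      ; only = only′ }
    where
    only′ : ∀ {w} → w ∈ t → w ≡ x ⊎ w ≡ y ⊎ w ≡ z
    only′ {w} w∈t with w ≟ x | w ≟ y | w ≟ z
    ... | yes w≡x | _ | _ = inj₁ w≡x
    ... | _ | yes w≡y | _ = inj₂ (inj₁ w≡y)
    ... | _ | _ | yes w≡z = inj₂ (inj₂ w≡z)
    ... | no w≢x | no w≢y | no w≢z = contradiction
      (x∈p∧x≢y⇒x∈p-y (x∈p∧x≢y⇒x∈p-y (x∈p∧x≢y⇒x∈p-y w∈t w≢x) w≢y) w≢z)
      (∣p∣≡0⇒x∉p ∣t-x-y-z∣)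

  -- The diagonal value makes third x an involution of all of Fin n.
  third : Fin n → Fin n → Fin n
  third x y with x ≟ y
  ... | yes _   = x
  ... | no  x≢y = proj₁ (block x≢y)

  line : ∀ {x y} → x ≢ y → ∃ (Line x y (third x y))
  line {x} {y} x≢y with x ≟ y
  ... | yes x≡y = contradiction x≡y x≢y
  ... | no  x≢y = proj₂ (block x≢y)

  third-diag : ∀ x → third x x ≡ x
  third-diag x with x ≟ x
  ... | yes _   = refl
  ... | no  x≢x = contradiction refl x≢x

  third-unique : ∀ {x y z t} → Line x y z t → third x y ≡ z
  third-unique {x} {y} l with t′ , l′ ← line (x≢y l)
    with refl ← proj₂ (proj₂ sts x y (x≢y l)) _ _ (t∈Δ l) (x∈t l) (y∈t l) (t∈Δ l′) (x∈t l′) (y∈t l′)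
    with only l (z∈t l′)
  ... | inj₁ eq        = contradiction (sym eq) (x≢z l′)
  ... | inj₂ (inj₁ eq) = contradiction (sym eq) (y≢z l′)
  ... | inj₂ (inj₂ eq) = eq

  third-involutive : ∀ x y → third x (third x y) ≡ y
  third-involutive x y with x ≟ y in eq
  ... | yes refl = third-diag x
  ... | no  x≢y  = third-unique (swap-yz (proj₂ (proj₂ (block x≢y))))

  -- Each new triple meets the old vertex set in exactly one point, so odd size, absence of cycles
  -- and connectedness all follow by induction.
  data Tree (r : Fin n) : Subset n → List (Subset n) → Set where
    root : Tree r ⁅ r ⁆ []
    grow : ∀ {S ts s x z t} → Tree r S ts → Line s x z t → s ∈ S → x ∉ S → z ∉ S →
           Tree r (S ∪ ⁅ x ⁆ ∪ ⁅ z ⁆) (t ∷ ts)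

  module _ {S : Subset n} {x z : Fin n} where

    old : S ⊆ S ∪ ⁅ x ⁆ ∪ ⁅ z ⁆
    old = p⊆p∪q _

    new-x : x ∈ S ∪ ⁅ x ⁆ ∪ ⁅ z ⁆
    new-x = q⊆p∪q S _ (p⊆p∪q _ (x∈⁅x⁆ x))

    new-z : z ∈ S ∪ ⁅ x ⁆ ∪ ⁅ z ⁆
    new-z = q⊆p∪q S _ (q⊆p∪q ⁅ x ⁆ _ (x∈⁅x⁆ z))

    new⁻ : ∀ {w} → w ∈ S ∪ ⁅ x ⁆ ∪ ⁅ z ⁆ → w ∈ S ⊎ w ≡ x ⊎ w ≡ z
    new⁻ w∈ with x∈p∪q⁻ S _ w∈
    ... | inj₁ w∈S = inj₁ w∈S
    ... | inj₂ w∈  with x∈p∪q⁻ ⁅ x ⁆ _ w∈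
    ...   | inj₁ w∈x = inj₂ (inj₁ (x∈⁅y⁆⇒x≡y x w∈x))
    ...   | inj₂ w∈z = inj₂ (inj₂ (x∈⁅y⁆⇒x≡y z w∈z))

  line∩S : ∀ {S : Subset n} {s x z t} → Line s x z t → x ∉ S → z ∉ S → ∀ {w} → w ∈ t → w ∈ S → w ≡ s
  line∩S l x∉S z∉S w∈t w∈S with only l w∈t
  ... | inj₁ w≡s         = w≡s
  ... | inj₂ (inj₁ refl) = contradiction w∈S x∉S
  ... | inj₂ (inj₂ refl) = contradiction w∈S z∉S

  line⊆ : ∀ {S : Subset n} {s x z t} → Line s x z t → s ∈ S → t ⊆ S ∪ ⁅ x ⁆ ∪ ⁅ z ⁆
  line⊆ l s∈S w∈t with only l w∈t
  ... | inj₁ refl        = old s∈S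
  ... | inj₂ (inj₁ refl) = new-x
  ... | inj₂ (inj₂ refl) = new-z

  ∣grow∣ : ∀ {S : Subset n} {x z} → x ≢ z → x ∉ S → z ∉ S → ∣ S ∪ ⁅ x ⁆ ∪ ⁅ z ⁆ ∣ ≡ 2 + ∣ S ∣
  ∣grow∣ {S} {x} {z} x≢z x∉S z∉S = begin
    ∣ S ∪ ⁅ x ⁆ ∪ ⁅ z ⁆ ∣   ≡⟨ cong ∣_∣ (sym (∪-assoc S ⁅ x ⁆ ⁅ z ⁆)) ⟩
    ∣ (S ∪ ⁅ x ⁆) ∪ ⁅ z ⁆ ∣ ≡⟨ ∣p∪x∣ z∉ ⟩
    suc ∣ S ∪ ⁅ x ⁆ ∣       ≡⟨ cong suc (∣p∪x∣ x∉S) ⟩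
    2 + ∣ S ∣               ∎
    where
    open ≡-Reasoning
    z∉ : z ∉ S ∪ ⁅ x ⁆
    z∉ z∈ with x∈p∪q⁻ S _ z∈
    ... | inj₁ z∈S = z∉S z∈S
    ... | inj₂ z∈x = x≢z (sym (x∈⁅y⁆⇒x≡y x z∈x))

  module _ {r : Fin n} where

    tree-odd : ∀ {S ts} → Tree r S ts → parity ∣ S ∣ ≡ 1ℙ
    tree-odd root = cong parity (∣⁅x⁆∣≡1 r)
    tree-odd (grow T l _ x∉S z∉S) = trans (cong parity (∣grow∣ (y≢z l) x∉S z∉S)) (tree-odd T)

    tree⊆Δ : ∀ {S ts} → Tree r S ts → ∀ {t} → t ∈ₗ ts → Δ t
    tree⊆Δ (grow T l _ _ _) (here refl) = t∈Δ l
    tree⊆Δ (grow T _ _ _ _) (there t∈)  = tree⊆Δ T t∈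

    triple⊆tree : ∀ {S ts} → Tree r S ts → ∀ {t} → t ∈ₗ ts → t ⊆ S
    triple⊆tree (grow T l s∈S _ _) (here refl) = line⊆ l s∈S
    triple⊆tree (grow T _ _ _ _)   (there t∈)  = old ∘ triple⊆tree T t∈

    reach-mono : ∀ {t} {ts : List (Subset n)} {u v} → Reach (_∈ₗ ts) u v → Reach (_∈ₗ (t ∷ ts)) u v
    reach-mono here = here
    reach-mono (step t u↝w t∈ w∈t v∈t) = step t (reach-mono u↝w) (there t∈) w∈t v∈t

    tree-reach : ∀ {S ts} → Tree r S ts → ∀ {v} → v ∈ S → Reach (_∈ₗ ts) r v
    tree-reach root v∈ with refl ← x∈⁅y⁆⇒x≡y r v∈ = here
    tree-reach (grow {x = x} {z} T l s∈S _ _) v∈ with new⁻ {x = x} {z} v∈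
    ... | inj₁ v∈S         = reach-mono (tree-reach T v∈S)
    ... | inj₂ (inj₁ refl) = step _ (reach-mono (tree-reach T s∈S)) (here refl) (x∈t l) (y∈t l)
    ... | inj₂ (inj₂ refl) = step _ (reach-mono (tree-reach T s∈S)) (here refl) (x∈t l) (z∈t l)

    -- The last grown triple of a cycle would meet the earlier part of the tree
    -- in two consecutive vertices of the cycle.
    tree-acyclic : ∀ {S ts} → Tree r S ts → ¬ HasCycle (_∈ₗ ts)
    tree-acyclic root (ℓ , a , t , 2≤ℓ , closed , a-inj , t-inj , edges)
      with () ← proj₁ (edges 0 (≤-trans (s≤s z≤n) 2≤ℓ))
    tree-acyclic (grow {S} {ts} {t = t′} T l s∈S x∉S z∉S) (ℓ@(suc (suc k)) , a , t , 2≤ℓ@(s≤s (s≤s _)) , closed , a-inj , t-inj , edges)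
      with anyUpTo? (λ i → ≡-dec _≟ᵇ_ (t i) t′) ℓ
    ... | no ∄i = tree-acyclic T (ℓ , a , t , 2≤ℓ , closed , a-inj , t-inj , λ i i<ℓ →
          (case proj₁ (edges i i<ℓ) of λ where
            (here tᵢ≡t′) → contradiction (i , i<ℓ , tᵢ≡t′) ∄i
            (there tᵢ∈)  → tᵢ∈) , proj₂ (edges i i<ℓ))
    ... | yes (i , i<ℓ , refl) = aᵢ≢aᵢ₊₁ (trans (at-s (proj₁ (proj₂ (edges i i<ℓ))) (aᵢ∈S i i<ℓ earlier))
                                              (sym (at-s (proj₂ (proj₂ (edges i i<ℓ))) aᵢ₊₁∈S)))
      where
      at-s : ∀ {w} → w ∈ t i → w ∈ S → w ≡ _
      at-s = line∩S l x∉S z∉S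

      earlier : ∀ j → j < ℓ → j ≢ i → t j ⊆ S
      earlier j j<ℓ j≢i with proj₁ (edges j j<ℓ)
      ... | here tⱼ≡tᵢ = contradiction tⱼ≡tᵢ (t-inj j i j<ℓ i<ℓ j≢i)
      ... | there tⱼ∈  = triple⊆tree T tⱼ∈

      -- The vertex also lies on the preceding triple of the cycle; for index 0 this is the last
      -- triple, of index `suc k`, by `closed`.
      aᵢ∈S : ∀ i → i < ℓ → (∀ j → j < ℓ → j ≢ i → t j ⊆ S) → a i ∈ S
      aᵢ∈S (suc i) i<ℓ earlier =
        let i<ℓ′ = ≤-trans (n≤1+n _) i<ℓ in
        earlier i i<ℓ′ (λ ()) (proj₂ (proj₂ (edges i i<ℓ′)))
      aᵢ∈S zero _ earlier =
        subst (_∈ S) closed (earlier (suc k) (n<1+n _) (λ ()) (proj₂ (proj₂ (edges (suc k) (n<1+n _)))))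

      -- After the last index the cycle returns to `a 0`; that the last index is not 0 comes from
      -- `2 ≤ ℓ`.
      wrap : ¬ suc i < ℓ → a (suc i) ≡ a 0 × 0 ≢ i
      wrap i+1≮ℓ with i+1≡ℓ ← ≤-antisym i<ℓ (≮⇒≥ i+1≮ℓ) =
        trans (cong a i+1≡ℓ) closed , λ { refl → case i+1≡ℓ of λ () }

      aᵢ₊₁∈S : a (suc i) ∈ S
      aᵢ₊₁∈S with suc i <? ℓ
      ... | yes i+1<ℓ = earlier (suc i) i+1<ℓ (λ ()) (proj₁ (proj₂ (edges (suc i) i+1<ℓ)))
      ... | no  i+1≮ℓ with aᵢ₊₁≡a₀ , 0≢i ← wrap i+1≮ℓ =
        subst (_∈ S) (sym aᵢ₊₁≡a₀) (earlier 0 (s≤s z≤n) 0≢i (proj₁ (proj₂ (edges 0 (s≤s z≤n)))))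

      aᵢ≢aᵢ₊₁ : a i ≢ a (suc i)
      aᵢ≢aᵢ₊₁ with suc i <? ℓ
      ... | yes i+1<ℓ = a-inj i (suc i) i<ℓ i+1<ℓ λ ()
      ... | no  i+1≮ℓ with aᵢ₊₁≡a₀ , 0≢i ← wrap i+1≮ℓ =
        λ eq → a-inj i 0 i<ℓ (s≤s z≤n) (0≢i ∘ sym) (trans eq aᵢ₊₁≡a₀)

  reach-trans : ∀ {T : TripleSet n} {u v w} → Reach T u v → Reach T v w → Reach T u w
  reach-trans u↝v here = u↝v
  reach-trans u↝v (step t v↝w t∈ w∈t x∈t) = step t (reach-trans u↝v v↝w) t∈ w∈t x∈t

  reach-sym : ∀ {T : TripleSet n} {u v} → Reach T u v → Reach T v u
  reach-sym here = here
  reach-sym (step t u↝w t∈ w∈t v∈t) = reach-trans (step t here t∈ v∈t w∈t) (reach-sym u↝w)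

  reach⇒covered : ∀ {T : TripleSet n} {u v} → u ≢ v → Reach T u v → ∃ λ t → T t × v ∈ t
  reach⇒covered u≢v here = contradiction refl u≢v
  reach⇒covered u≢v (step t _ t∈ _ v∈t) = t , t∈ , v∈t

  tree⇒spanning : ∀ {r ts} → 1 < n → Tree r ⊤ ts → IsSpanningTree Δ (_∈ₗ ts)
  tree⇒spanning {r} {ts} 1<n T = (λ _ → tree⊆Δ T) , tree-acyclic T , covered , connected
    where
    connected : ∀ u v → Reach (_∈ₗ ts) u v
    connected u v = reach-trans (reach-sym (tree-reach T ∈⊤)) (tree-reach T ∈⊤)
    covered : ∀ x → Σ (Subset n) λ t → t ∈ₗ ts × x ∈ t
    -- As `1 < n`, there is a second vertex `y`, and the last triple on a path from `y` to `x`
    -- covers `x`.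
    covered x with y , y∉ ← ∃∉ {p = ⁅ x ⁆} (≤-trans (s≤s (≤-reflexive (∣⁅x⁆∣≡1 x))) 1<n)
      = reach⇒covered (λ { refl → y∉ (x∈⁅x⁆ x) }) (connected y x)

-- Counting the completions of a tree

  -- The fields `contains` and `thin` are the invariants by which `branch` separates trees: a chosen
  -- triple persists, and a later one meets `S` in at most one vertex.
  record Completions (r : Fin n) (S : Subset n) (ts : List (Subset n)) (L : ℕ) : Set where
    field
      tree     : Fin L → List (Subset n)
      spanning : ∀ i → Tree r ⊤ (tree i)
      thin     : ∀ i {t} → t ∈ₗ tree i →
                 t ∈ₗ ts ⊎ (∀ {v w} → v ∈ t → w ∈ t → v ∈ S → w ∈ S → v ≡ w)
      contains : ∀ i {t} → t ∈ₗ ts → t ∈ₗ tree i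
      distinct : ∀ {i j} → i ≢ j → ∃ λ t → t ∈ₗ tree i × t ∉ₗ tree j

  open Completions

  private variable
    r : Fin n
    S : Subset n
    ts : List (Subset n)
    K L m : ℕ

  full : Tree r S ts → ¬ ∣ S ∣ < n → Completions r S ts 1
  full {r} {S} {ts} T ∣S∣≮n = record
    { tree     = λ _ → ts
    ; spanning = λ _ → subst (λ S → Tree r S ts) (∣p∣≡n⇒p≡⊤ (≤-antisym (∣p∣≤n S) (≮⇒≥ ∣S∣≮n))) T
    ; thin     = λ _ → inj₁
    ; contains = λ _ t∈ → t∈
    ; distinct = λ { {zero} {zero} i≢j → contradiction refl i≢j }
    }

  -- Branching at a fixed x ∉ S: the branch through e i has a triple containing both x
  -- and e i, which the branch through e j can only acquire as its own triple at x.
  branch : ∀ {x} → Tree r S ts → x ∉ S → (e : Fin K → Fin n) → (∀ i j → e i ≡ e j → i ≡ j) →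
    (∀ i → e i ∈ S × third (e i) x ∉ S) →
    (∀ {S′ ts′} → Tree r S′ ts′ → ∣ S′ ∣ ≡ 2 + ∣ S ∣ → Completions r S′ ts′ L) →
    Completions r S ts (K * L)
  branch {r} {S} {ts} {K} {L} {x} T x∉S e e-inj good complete = record
    { tree     = tree′ ∘ split
    ; spanning = λ k → spanning (below (proj₁ (split k))) (proj₂ (split k))
    ; thin     = thin′ ∘ split
    ; contains = λ k t∈ → contains (below (proj₁ (split k))) (proj₂ (split k)) (there t∈)
    ; distinct = λ {k} {l} k≢l → distinct′ (split k) (split l) λ eq →
        k≢l (trans (sym (combine-remQuot {K} L k))
               (trans (cong (λ (i , j) → combine i j) eq) (combine-remQuot {K} L l)))
    }
    where
    split : Fin (K * L) → Fin K × Fin L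
    split = remQuot {K} L

    e≢x : ∀ i → e i ≢ x
    e≢x i refl = x∉S (proj₁ (good i))

    tᵢ : Fin K → Subset n
    tᵢ i = proj₁ (line (e≢x i))

    lineᵢ : ∀ i → Line (e i) x (third (e i) x) (tᵢ i)
    lineᵢ i = proj₂ (line (e≢x i))

    tᵢ∩S : ∀ i {w} → w ∈ tᵢ i → w ∈ S → w ≡ e i
    tᵢ∩S i = line∩S (lineᵢ i) x∉S (proj₂ (good i))

    below : ∀ i → Completions r _ (tᵢ i ∷ ts) L
    below i = complete (grow T (lineᵢ i) (proj₁ (good i)) x∉S (proj₂ (good i)))
                       (∣grow∣ (y≢z (lineᵢ i)) x∉S (proj₂ (good i)))

    tree′ : Fin K × Fin L → List (Subset n)
    tree′ (i , j) = tree (below i) j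

    thin′ : ∀ ij {t} → t ∈ₗ tree′ ij → t ∈ₗ ts ⊎ (∀ {v w} → v ∈ t → w ∈ t → v ∈ S → w ∈ S → v ≡ w)
    thin′ (i , j) t∈ with thin (below i) j t∈
    ... | inj₁ (here refl) = inj₂ λ v∈ w∈ v∈S w∈S → trans (tᵢ∩S i v∈ v∈S) (sym (tᵢ∩S i w∈ w∈S))
    ... | inj₁ (there t∈)  = inj₁ t∈
    -- Thinness for the enlarged vertex set implies thinness for `S`.
    ... | inj₂ thin        = inj₂ λ v∈ w∈ v∈S w∈S → thin v∈ w∈ (old v∈S) (old w∈S)

    distinct′ : ∀ p q → p ≢ q → ∃ λ t → t ∈ₗ tree′ p × t ∉ₗ tree′ q
    distinct′ (i , j) (k , l) p≢q with i ≟ k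
    ... | yes refl = distinct (below i) {j} {l} (p≢q ∘ cong (i ,_))
    ... | no  i≢k  = tᵢ i , contains (below i) j (here refl) , absent
      where
      -- There are three possible sources: `tᵢ k` meets `S` only in `e k`, older triples lie inside
      -- `S` and miss `x`, and later ones cannot contain both `e i` and `x`.
      absent : tᵢ i ∉ₗ tree (below k) l
      absent t∈ with thin (below k) l t∈
      ... | inj₁ (here tᵢ≡tₖ) = i≢k (e-inj i k
              (tᵢ∩S k (subst (e i ∈_) tᵢ≡tₖ (x∈t (lineᵢ i))) (proj₁ (good i))))
      ... | inj₁ (there t∈ts) = x∉S (triple⊆tree T t∈ts (y∈t (lineᵢ i)))
      ... | inj₂ thin         = e≢x i (thin (x∈t (lineᵢ i)) (y∈t (lineᵢ i)) (old (proj₁ (good i))) new-x)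

  -- The count is uniform over all trees of a given size, so the numbers of choices at successive
  -- sizes multiply.
  Completable : ℕ → ℕ → Set
  Completable m L = ∀ {r S ts} → Tree r S ts → ∣ S ∣ ≡ m → Completions r S ts L

  -- If every s ∈ S had its third point with x in S, then these third points would pair up S,
  -- whose cardinality is odd.
  exit : ∀ {x} → Tree r S ts → x ∉ S → ∃ λ s → s ∈ S × third s x ∉ S
  exit {S = S} {x = x} T x∉S with any? (λ s → (s ∈? S) ×-dec ¬? (third s x ∈? S))
  ... | yes found = found
  ... | no  none = contradiction
    (trans (sym (tree-odd T)) (involution⇒even (λ s → third s x) ∣ S ∣ S ≤-refl paired)) λ ()
    where
    paired : ∀ {s} → s ∈ S → third s x ∈ S × third s x ≢ s × third (third s x) x ≡ s
    paired {s} s∈S with _ , l ← line {s} {x} (λ { refl → x∉S s∈S }) =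
      decidable-stable (third s x ∈? S) (λ ∉S → none (s , s∈S , ∉S))
      , x≢z l ∘ sym , third-unique (swap-xy (swap-yz (swap-xy l)))

  one-way : m < n → Completable (2 + m) L → Completable m L
  one-way {m} {L} m<n below {r} {S} {ts} T refl
    with x , x∉S ← ∃∉ {p = S} m<n
    with s , s∈S , z∉S ← exit T x∉S
    = subst (Completions r S ts) (*-identityˡ L)
        (branch T x∉S (λ (_ : Fin 1) → s) (λ { zero zero _ → refl }) (λ _ → s∈S , z∉S) below)

  -- The fuel `d` bounds the number of missing vertices; every step adds two, so it lasts until the
  -- tree spans.
  completable : ∀ d m → n ≤ m + d → Completable m 1
  completable zero m n≤m+0 T refl = full T λ m<n →
    <⇒≱ m<n (subst (n ≤_) (+-identityʳ m) n≤m+0)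
  completable (suc d) m n≤m+d T eq with m <? n
  ... | yes m<n = one-way m<n
        (completable d (2 + m) (≤-trans n≤m+d (≤-trans (≤-reflexive (+-suc m d)) (n≤1+n _)))) T eq
  ... | no  m≮n = full T (m≮n ∘ subst (_< n) eq)

  -- This bridges the small sizes, where only one continuation per step is counted.
  one-ways : ∀ i m → m + 2 * i ≤ n → Completable (m + 2 * i) L → Completable m L
  one-ways {L} zero m _ = subst (λ m → Completable m L) (+-identityʳ m)
  one-ways {L} (suc i) m bound below =
    one-way (≤-trans (≤-trans (n≤1+n _) (m≤m+n (2 + m) (2 * i))) bound′)
      (one-ways i (2 + m) bound′ (subst (λ m → Completable m L) shift below))
    where
    shift : m + 2 * suc i ≡ 2 + m + 2 * i
    shift = lemma m i
      where
      lemma : ∀ m i → m + 2 * suc i ≡ 2 + m + 2 * i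
      lemma = solve-∀
    bound′ = subst (_≤ n) shift bound

  -- Double counting of exits

  module _ (S : Subset n) where

    -- This is the condition for the triple through `s` and `x` to meet `S` in `s` alone, so that
    -- the tree can grow by it.
    Exit : Fin n → Fin n → Set
    Exit x s = x ∉ S × s ∈ S × third s x ∉ S

    exit? : ∀ x s → Dec (Exit x s)
    exit? x s = ¬? (x ∈? S) ×-dec (s ∈? S) ×-dec ¬? (third s x ∈? S)

    -- For fixed `s`, a vertex `x` is lost only if `x` or `third s x` lies in `S`. As `third s` is a
    -- permutation, each case accounts for `∣ S ∣` vertices.
    exits-to : ∀ s → s ∈ S → n ≤ ∣ S ∣ + ∣ S ∣ + card (λ x → exit? x s)
    exits-to s s∈S = begin
      n
        ≡⟨ trans (sym (*-identityʳ n)) (sym (sum-const n 1)) ⟩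
      sum {n} (λ _ → 1)
        ≤⟨ sum-mono cover ⟩
      sum (λ x → ind (x ∈? S) + ind (third s x ∈? S) + ind (exit? x s))
        ≡⟨ ∑-distrib-+ (λ x → ind (x ∈? S) + ind (third s x ∈? S)) _ ⟩
      sum (λ x → ind (x ∈? S) + ind (third s x ∈? S)) + exits
        ≡⟨ cong (_+ exits) (∑-distrib-+ (λ x → ind (x ∈? S)) _) ⟩
      card (_∈? S) + sum (λ x → ind (third s x ∈? S)) + exits
        ≡⟨ cong (λ c → card (_∈? S) + c + exits) (sym (sum-permute (λ x → ind (x ∈? S)) π)) ⟩
      card (_∈? S) + card (_∈? S) + exits
        ≡⟨ cong (λ c → c + c + exits) (sym (∣p∣≡card S)) ⟩
      ∣ S ∣ + ∣ S ∣ + exits ∎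
      where
      open ≤-Reasoning
      exits = card (λ x → exit? x s)
      π = permutation (third s) (third s) (third-involutive s) (third-involutive s)
      cover : ∀ x → 1 ≤ ind (x ∈? S) + ind (third s x ∈? S) + ind (exit? x s)
      cover x with x ∈? S | s ∈? S | third s x ∈? S
      ... | yes _ | _       | _     = s≤s z≤n
      ... | no  _ | yes _   | yes _ = s≤s z≤n
      ... | no  _ | yes _   | no  _ = s≤s z≤n
      ... | no  _ | no  s∉S | _     = contradiction s∈S s∉S

    -- Every `s ∈ S` has at least `n ∸ (∣ S ∣ + ∣ S ∣)` exits. If each `x` took part in at most `k`
    -- of them, the total would be at most `n * k`.
    many-exits : ∀ k → n * k < ∣ S ∣ * (n ∸ (∣ S ∣ + ∣ S ∣)) → ∃ λ x → suc k ≤ card (exit? x)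
    many-exits k large with any? (λ x → suc k ≤? card (exit? x))
    ... | yes found = found
    ... | no  none  = contradiction (begin
      ∣ S ∣ * c                              ≡⟨ cong (_* c) (∣p∣≡card S) ⟩
      card (_∈? S) * c                       ≡⟨ sum-*ʳ (λ s → ind (s ∈? S)) c ⟨
      sum (λ s → ind (s ∈? S) * c)           ≤⟨ sum-mono (λ s → ind-*-≤ (s ∈? S) (m≤n+o⇒m∸n≤o _ _ ∘ exits-to s)) ⟩
      sum (λ s → card (λ x → exit? x s))     ≡⟨ ∑-comm (λ x s → ind (exit? x s)) ⟨
      sum (λ x → card (exit? x))             ≤⟨ sum-mono (λ x → ≮⇒≥ (λ k< → none (x , k<))) ⟩
      sum {n} (λ _ → k)                      ≡⟨ sum-const n k ⟩
      n * k                                  ∎) (<⇒≱ large)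
      where
      open ≤-Reasoning
      c = n ∸ (∣ S ∣ + ∣ S ∣)

  many-ways : ∀ k → n * k < m * (n ∸ (m + m)) → Completable (2 + m) L → Completable m (suc k * L)
  many-ways k large below {S = S} T refl
    with x , k< ← many-exits S k large
    with e , e-exit , e-inj ← enumerate (exit? S x)
    -- Only the first `suc k` listed exits are used; the very first also witnesses `x ∉ S`.
    = branch T (proj₁ (e-exit (inject≤ zero k<))) (λ i → e (inject≤ i k<))
        (λ i j eq → inject≤-injective k< k< i j (e-inj _ _ eq))
        (λ i → proj₂ (e-exit (inject≤ i k<))) below

  -- Each of `j` branching steps between the sizes `lo` and `hi` contributes a factor `suc k`;
  -- `completable` then finishes every resulting tree.
  powers : ∀ k lo hi → (∀ m → lo ≤ m → 2 + m ≤ hi → n * k < m * (n ∸ (m + m))) →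
    ∀ j m → lo ≤ m → m + 2 * j ≤ hi → Completable m (suc k ^ j)
  powers k lo hi large zero m _ _ = completable n m (m≤n+m n m)
  powers k lo hi large (suc j) m lo≤m bound =
    many-ways k (large m lo≤m (≤-trans (m≤m+n (2 + m) (2 * j)) bound′))
      (powers k lo hi large j (2 + m) (≤-trans lo≤m (≤-trans (n≤1+n m) (n≤1+n _))) bound′)
    where
    shift : ∀ m j → m + 2 * suc j ≡ 2 + m + 2 * j
    shift = solve-∀
    bound′ = subst (_≤ hi) (shift m j) bound

  spanning-trees : 1 < n → ∀ {L} → Completable 1 L → AtLeastSpanningTrees Δ L
  spanning-trees 1<n complete = (λ i → _∈ₗ tree all i)
    , (λ i → tree⇒spanning 1<n (spanning all i))
    , λ i j i≢j → let t , t∈ , t∉ = distinct all i≢j in t , inj₁ (t∈ , t∉)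
    where
    0<n = ≤-trans (n≤1+n _) 1<n
    all = complete {fromℕ< 0<n} root (∣⁅x⁆∣≡1 (fromℕ< 0<n))

-- Numerical estimates

-- With q = ⌊n/16⌋ and k = ⌊q/2⌋.
exits-estimate : ∀ n q k m → 16 * q ≤ n → n ≤ 15 + 16 * q → 2 * k ≤ q →
  -- Both sides are doubled so that `2 * k ≤ q` applies; the resulting quadratic inequality in `q`
  -- has slack `4 + q`.
  1 + 2 * q ≤ m → 2 + m ≤ 1 + 2 * q + 2 * (2 * q) → n * k < m * (n ∸ (m + m))
exits-estimate n q k m 16q≤n n≤ 2k≤q lo hi = *-cancelˡ-< 2 _ _ (begin-strict
  2 * (n * k)                          ≡⟨ shuffle n k ⟩
  n * (2 * k)                          ≤⟨ *-mono-≤ n≤ 2k≤q ⟩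
  (15 + 16 * q) * q                    <⟨ s≤s (m≤m+n _ (3 + q)) ⟩
  suc ((15 + 16 * q) * q + (3 + q))    ≡⟨ expand q ⟩
  2 * ((1 + 2 * q) * (2 + 4 * q))      ≤⟨ *-monoʳ-≤ 2 (*-mono-≤ lo (m+n≤o⇒m≤o∸n (2 + 4 * q) room)) ⟩
  2 * (m * (n ∸ (m + m)))              ∎)
  where
  open ≤-Reasoning
  shuffle : ∀ n k → 2 * (n * k) ≡ n * (2 * k)
  shuffle = solve-∀
  expand : ∀ q → suc ((15 + 16 * q) * q + (3 + q)) ≡ 2 * ((1 + 2 * q) * (2 + 4 * q))
  expand = solve-∀
  double : ∀ q m → 2 + (2 + 4 * q + (m + m)) ≡ 4 * q + ((2 + m) + (2 + m))
  double = solve-∀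
  sixteen : ∀ q → 4 * q + ((1 + 2 * q + 2 * (2 * q)) + (1 + 2 * q + 2 * (2 * q))) ≡ 2 + 16 * q
  sixteen = solve-∀
  -- From `m + 2 ≤ 1 + 6q` follows `2m + 2 ≤ 12q`, hence `n - 2m ≥ 4q + 2`. Adding 2 to both sides
  -- avoids subtraction.
  room : 2 + 4 * q + (m + m) ≤ n
  room = ≤-pred (≤-pred (begin
    2 + (2 + 4 * q + (m + m))          ≡⟨ double q m ⟩
    4 * q + ((2 + m) + (2 + m))        ≤⟨ +-monoʳ-≤ (4 * q) (+-mono-≤ hi hi) ⟩
    4 * q + ((1 + 2 * q + 2 * (2 * q)) + (1 + 2 * q + 2 * (2 * q))) ≡⟨ sixteen q ⟩
    2 + 16 * q                         ≤⟨ s≤s (s≤s 16q≤n) ⟩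
    2 + n                              ∎))

^-distribʳ-* : ∀ a b k → (a * b) ^ k ≡ a ^ k * b ^ k
^-distribʳ-* a b zero    = refl
^-distribʳ-* a b (suc k) = trans (cong (a * b *_) (^-distribʳ-* a b k)) (interchange a b (a ^ k) (b ^ k))
  where
  interchange : ∀ a b c d → a * b * (c * d) ≡ a * c * (b * d)
  interchange = solve-∀

-- The exponent `n` is at most `17 * q`, while the twelfth power of the tree count has exponent
-- `24 * q`. The surplus `K ^ 7` per unit of `q` absorbs `32 ^ 17`.
growth-estimate : ∀ n q K → n ≤ 32 * K → n ≤ 15 + 16 * q → 15 ≤ q → 8192 ≤ K →
  n ^ n ≤ 1 * (6 ^ n * (K ^ (2 * q)) ^ 12)
growth-estimate n q K n≤32K n≤ 15≤q K-large = begin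
  n ^ n                                ≤⟨ ^-monoˡ-≤ n n≤32K ⟩
  (32 * K) ^ n                         ≤⟨ ^-monoʳ-≤ (32 * K) (≤-trans n≤ (≤-trans (+-monoˡ-≤ (16 * q) 15≤q) (≤-reflexive (seventeen q)))) ⟩
  (32 * K) ^ (17 * q)                  ≡⟨ ^-*-assoc (32 * K) 17 q ⟨
  ((32 * K) ^ 17) ^ q                  ≤⟨ ^-monoˡ-≤ q base ⟩
  (K ^ 24) ^ q                         ≡⟨ ^-*-assoc K 24 q ⟩
  K ^ (24 * q)                         ≡⟨ cong (K ^_) (twenty-four q) ⟩
  K ^ (2 * q * 12)                     ≡⟨ ^-*-assoc K (2 * q) 12 ⟨
  (K ^ (2 * q)) ^ 12                   ≤⟨ m≤n*m _ (6 ^ n) ⟩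
  6 ^ n * (K ^ (2 * q)) ^ 12           ≡⟨ *-identityˡ _ ⟨
  1 * (6 ^ n * (K ^ (2 * q)) ^ 12)     ∎
  where
  open ≤-Reasoning
  instance
    K≢0 : NonZero K
    K≢0 = >-nonZero (≤-trans (s≤s z≤n) K-large)
    32K≢0 : NonZero (32 * K)
    32K≢0 = m*n≢0 32 K
    6ⁿ≢0 : NonZero (6 ^ n)
    6ⁿ≢0 = m^n≢0 6 n
  seventeen : ∀ q → q + 16 * q ≡ 17 * q
  seventeen = solve-∀
  twenty-four : ∀ q → 24 * q ≡ 2 * q * 12
  twenty-four = solve-∀
  -- 32 ^ 17 = 2 ^ 85 ≤ 2 ^ 91 = 8192 ^ 7
  base : (32 * K) ^ 17 ≤ K ^ 24
  base = begin
    (32 * K) ^ 17       ≡⟨ ^-distribʳ-* 32 K 17 ⟩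
    32 ^ 17 * K ^ 17    ≤⟨ *-monoˡ-≤ (K ^ 17) (≤-trans (≤ᵇ⇒≤ (32 ^ 17) (8192 ^ 7) _) (^-monoˡ-≤ 7 K-large)) ⟩
    K ^ 7 * K ^ 17      ≡⟨ ^-distribˡ-+-* K 7 17 ⟨
    K ^ 24              ∎

-- Division with remainder and the final choice of constants

m≤d+[1+d]*[m/[1+d]] : ∀ m d → m ≤ d + suc d * (m / suc d)
m≤d+[1+d]*[m/[1+d]] m d = begin
  m                                ≡⟨ m≡m%n+[m/n]*n m (suc d) ⟩
  m % suc d + m / suc d * suc d    ≤⟨ +-mono-≤ (≤-pred (m%n<n m (suc d))) (≤-reflexive (*-comm (m / suc d) (suc d))) ⟩
  d + suc d * (m / suc d)          ∎
  where open ≤-Reasoning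

[1+d]*[m/[1+d]]≤m : ∀ m d → suc d * (m / suc d) ≤ m
[1+d]*[m/[1+d]]≤m m d = ≤-trans (≤-reflexive (*-comm (suc d) (m / suc d))) (m/n*n≤m m (suc d))

-- The inequality is the twelfth power of `L ≥ c (n/6)^(n/12)` with `c ^ 12 = 1 / suc d`, cleared of
-- denominators.
theorem3p4 : Σ ℕ λ d → Σ ℕ λ N → ∀ (n : ℕ) → N ≤ n → (Δ : TripleSet n) → IsSTS Δ →
    Σ ℕ λ L → AtLeastSpanningTrees Δ L × n ^ n ≤ suc d * (6 ^ n * L ^ 12)
-- The threshold is `16 * 2 * 8192`, which makes `k` at least 8192.
theorem3p4 = 0 , 262144 , λ n N≤n Δ sts →
  let open Growth Δ sts
      open ≤-Reasoning
      q = n / 16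
      k = q / 2
      16384≤q : 16384 ≤ q
      16384≤q = /-monoˡ-≤ 16 N≤n
      8192≤k : 8192 ≤ k
      8192≤k = /-monoˡ-≤ 2 16384≤q
      16q≤n = [1+d]*[m/[1+d]]≤m n 15
      n≤15+16q = m≤d+[1+d]*[m/[1+d]] n 15
      n≤32[1+k] : n ≤ 32 * suc k
      n≤32[1+k] = begin
        n                           ≤⟨ n≤15+16q ⟩
        15 + 16 * q                 ≤⟨ +-monoʳ-≤ 15 (*-monoʳ-≤ 16 (m≤d+[1+d]*[m/[1+d]] q 1)) ⟩
        15 + 16 * (1 + 2 * k)       ≤⟨ n≤1+n _ ⟩
        16 + 16 * (1 + 2 * k)       ≡⟨ thirty-two k ⟩
        32 * suc k                  ∎
      1+2q≤n : 1 + 2 * q ≤ n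
      1+2q≤n = begin
        1 + 2 * q                   ≤⟨ +-monoˡ-≤ (2 * q) (≤-trans (≤ᵇ⇒≤ 1 16384 _) 16384≤q) ⟩
        3 * q                       ≤⟨ *-monoˡ-≤ q (≤ᵇ⇒≤ 3 16 _) ⟩
        16 * q                      ≤⟨ 16q≤n ⟩
        n                           ∎
  in suc k ^ (2 * q)
   , spanning-trees (≤-trans (≤ᵇ⇒≤ 2 262144 _) N≤n)
       -- The size goes from 1 to `1 + 2 * q` in `q` single steps, then to `1 + 6 * q` in `2 * q`
       -- branching steps.
       (one-ways q 1 1+2q≤n
         (powers k (1 + 2 * q) (1 + 2 * q + 2 * (2 * q))
           (λ m → exits-estimate n q k m 16q≤n n≤15+16q ([1+d]*[m/[1+d]]≤m q 1))
           (2 * q) (1 + 2 * q) ≤-refl ≤-refl))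
   , growth-estimate n q (suc k) n≤32[1+k] n≤15+16q
       (≤-trans (≤ᵇ⇒≤ 15 16384 _) 16384≤q) (≤-trans 8192≤k (n≤1+n k))
  where
  thirty-two : ∀ k → 16 + 16 * (1 + 2 * k) ≡ 32 * suc k
  thirty-two = solve-∀
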